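{- Let $G$ be a group and $c\in G$. If the set $\{x\in G:x^2=c\}$ is $4$-large in $G$, then $G$ is abelian of exponent $2$, and $c=1$.
   Context: A subset $X\subseteq G$ is $k$-large in $G$ if the intersection of any $k$ left translates $g_1X\cap\dots\cap g_kX$ ($g_i\in G$) is non-empty. -}

module Defs where

open import Level using (Level; _⊔_)
open import Algebra.Bundles using (Group)
open import Data.Fin using (Fin)
open import Data.Nat using (ℕ)
open import Data.Product using (∃-syntax; _×_)
open import Relation.Unary using (Pred; _∈_; Satisfiable; ⋂)

module _ {a ℓ : Level} (G : Group a ℓ) where
  open Group G

  LeftTranslate : {p : Level} → Carrier → Pred Carrier p → Pred Carrier (a ⊔ ℓ ⊔ p)
  LeftTranslate g X y = ∃[ x ] (x ∈ X × y ≈ g ∙ x)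

  -- The translating elements need not be distinct.
  Large : {p : Level} → ℕ → Pred Carrier p → Set (a ⊔ ℓ ⊔ p)
  Large k X = (g : Fin k → Carrier) → Satisfiable (⋂ (Fin k) (λ i → LeftTranslate (g i) X))

  SquareRoots : Carrier → Pred Carrier ℓ
  SquareRoots c x = x ∙ x ≈ c

  -- Exponent 2 in the sense "every square is trivial"; the trivial group,
  -- whose least exponent is 1, is included.
  HasExponent2 : Set (a ⊔ ℓ)
  HasExponent2 = ∀ x → x ∙ x ≈ ε

{-# OPTIONS --safe #-}

-- If y and h⁻¹y both square to c, then hyh = y. By 4-largeness, for any g and h
-- some square root y of c satisfies this for g, h and gh at once, so
-- ghy(hg) = gyg = y = ghy(gh), and cancelling ghy gives hg = gh. In the now
-- abelian group, hyh = y says h² = 1.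
module Submission where

open import Defs
open import Level using (Level)
open import Algebra.Bundles using (Group)
open import Algebra.Structures using (IsAbelianGroup)
open import Data.Fin using (zero; suc)
open import Data.Product using (_×_; _,_; ∃-syntax)
open import Data.Vec.Functional using ([]; _∷_)
open import Relation.Unary using (_∈_)
import Algebra.Properties.Group as GroupProperties
import Relation.Binary.Reasoning.Setoid as SetoidReasoning

module _ {a ℓ : Level} (G : Group a ℓ) (c : Group.Carrier G) where
  open Group G
  open GroupProperties G using (∙-cancelˡ; ∙-cancelʳ; identityʳ-unique)
  open SetoidReasoning setoid

  translate-ε : ∀ {y} → y ∈ LeftTranslate G ε (SquareRoots G c) → y ∈ SquareRoots G c
  translate-ε {y} (x , xx≈c , y≈εx) = trans (∙-cong y≈x y≈x) xx≈c
    where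
    y≈x : y ≈ x
    y≈x = trans y≈εx (identityˡ x)

  -- The witness `x` of the translate stands for h⁻¹y. Both (yh)x = yy and xx equal c, so cancelling
  -- `x` on the right gives yh = x, and multiplying by `h` on the left returns `y`.
  common-root⇒sandwich : ∀ {h y} → y ∈ SquareRoots G c →
                         y ∈ LeftTranslate G h (SquareRoots G c) → h ∙ (y ∙ h) ≈ y
  common-root⇒sandwich {h} {y} yy≈c (x , xx≈c , y≈hx) = begin
    h ∙ (y ∙ h)  ≈⟨ ∙-congˡ yh≈x ⟩
    h ∙ x        ≈⟨ y≈hx ⟨
    y            ∎
    where
    yh≈x : y ∙ h ≈ x
    yh≈x = ∙-cancelʳ x (y ∙ h) x (begin
      (y ∙ h) ∙ x  ≈⟨ assoc y h x ⟩
      y ∙ (h ∙ x)  ≈⟨ ∙-congˡ y≈hx ⟨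
      y ∙ y        ≈⟨ yy≈c ⟩
      c            ≈⟨ xx≈c ⟨
      x ∙ x        ∎)

  module _ (large : Large G 4 (SquareRoots G c)) where

    sandwiching-root : ∀ g h → ∃[ y ] (y ∈ SquareRoots G c × g ∙ (y ∙ g) ≈ y ×
                         h ∙ (y ∙ h) ≈ y × (g ∙ h) ∙ (y ∙ (g ∙ h)) ≈ y)
    -- The translate by `ε` makes `y` itself a root of `c`; each of the other three then yields one
    -- sandwich identity.
    sandwiching-root g h with large (ε ∷ g ∷ h ∷ (g ∙ h) ∷ [])
    ... | y , y∈ = y , yy≈c
                     , common-root⇒sandwich yy≈c (y∈ (suc zero))
                     , common-root⇒sandwich yy≈c (y∈ (suc (suc zero)))
                     , common-root⇒sandwich yy≈c (y∈ (suc (suc (suc zero))))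
      where
      yy≈c : y ∈ SquareRoots G c
      yy≈c = translate-ε (y∈ zero)

    large⇒comm : ∀ g h → g ∙ h ≈ h ∙ g
    large⇒comm g h with sandwiching-root g h
    ... | y , _ , gyg≈y , hyh≈y , ghygh≈y =
      ∙-cancelˡ y (g ∙ h) (h ∙ g) (∙-cancelˡ (g ∙ h) _ _ (begin
        (g ∙ h) ∙ (y ∙ (g ∙ h))  ≈⟨ ghygh≈y ⟩
        y                        ≈⟨ gyg≈y ⟨
        g ∙ (y ∙ g)              ≈⟨ ∙-congˡ (∙-congʳ hyh≈y) ⟨
        g ∙ ((h ∙ (y ∙ h)) ∙ g)  ≈⟨ ∙-congˡ (assoc h (y ∙ h) g) ⟩
        g ∙ (h ∙ ((y ∙ h) ∙ g))  ≈⟨ assoc g h _ ⟨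
        (g ∙ h) ∙ ((y ∙ h) ∙ g)  ≈⟨ ∙-congˡ (assoc y h g) ⟩
        (g ∙ h) ∙ (y ∙ (h ∙ g))  ∎))

    large⇒exponent2 : HasExponent2 G
    -- Only the sandwich by `g` is wanted here; `ε` fills the second slot.
    large⇒exponent2 g with sandwiching-root g ε
    ... | y , _ , gyg≈y , _ = identityʳ-unique y (g ∙ g) (begin
      y ∙ (g ∙ g)  ≈⟨ assoc y g g ⟨
      -- Commutativity moves the last `g` to the front, so `g ∙ g` fixes `y` and must be `ε`.
      (y ∙ g) ∙ g  ≈⟨ large⇒comm (y ∙ g) g ⟩
      g ∙ (y ∙ g)  ≈⟨ gyg≈y ⟩
      y            ∎)

    large⇒c≈ε : c ≈ ε
    -- Any root of `c` serves: its square is `c` by choice and `ε` by exponent 2.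
    large⇒c≈ε with sandwiching-root ε ε
    ... | y , yy≈c , _ = trans (sym yy≈c) (large⇒exponent2 y)

theorem4p1 : {a ℓ : Level} (G : Group a ℓ) (c : Group.Carrier G) →
    let open Group G in
    Large G 4 (SquareRoots G c) →
    IsAbelianGroup _≈_ _∙_ ε _⁻¹ × HasExponent2 G × c ≈ ε
theorem4p1 G c large =
  record { isGroup = Group.isGroup G ; comm = large⇒comm G c large }
  , large⇒exponent2 G c large
  , large⇒c≈ε G c large
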